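{- Addition is not first-order definable in the structure $\langle\mathbb{Q},\cdot,\leqslant\rangle$; that is, there is no first-order formula $\varphi(x,y,z)$ in the language $\{\cdot,\leqslant\}$ such that for all $x,y,z\in\mathbb{Q}$, $x+y=z$ if and only if $\varphi(x,y,z)$ holds in $\langle\mathbb{Q},\cdot,\leqslant\rangle$.
   Context: $\langle\mathbb{Q},\cdot,\leqslant\rangle$ is the first-order structure whose domain is the set of all rational numbers, with the usual multiplication and the usual (non-strict) order. Definability is meant without parameters. -}

module Defs where

open import Data.Nat.Base using (ℕ; suc)
open import Data.Fin.Base using (Fin)
open import Data.Vec.Base using (Vec; _∷_; lookup)
open import Data.Product.Base using (_×_; ∃)
open import Data.Sum.Base using (_⊎_)
open import Data.Empty using (⊥)
open import Data.Rational.Base as ℚ using (ℚ)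
open import Relation.Binary.PropositionalEquality.Core using (_≡_)

-- First-order logic with equality over the language {·, ≤}, without constants.
-- The index n bounds the free variables, which are de Bruijn indices.

infixl 7 _·_
data Term (n : ℕ) : Set where
  var : Fin n → Term n
  _·_ : Term n → Term n → Term n

infix  6 _≐_ _≼_
infixr 5 _∧_
infixr 4 _∨_
infixr 3 _⇒_
data Formula (n : ℕ) : Set where
  _≐_ _≼_     : Term n → Term n → Formula n
  ⊥′          : Formula n
  _∧_ _∨_ _⇒_ : Formula n → Formula n → Formula n
  ∀′ ∃′       : Formula (suc n) → Formula n

record Structure : Set₁ where
  field
    Carrier : Set
    mul     : Carrier → Carrier → Carrier
    le      : Carrier → Carrier → Set

open Structure

eval : ∀ (M : Structure) {n} → Term n → Vec (Carrier M) n → Carrier M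
eval M (var i) ρ = lookup ρ i
eval M (s · t) ρ = mul M (eval M s ρ) (eval M t ρ)

-- Tarskian satisfaction, with the connectives read in the constructive
-- metatheory.  This loses nothing for undefinability: all connectives are
-- primitive, so the Gödel–Gentzen translation of a formula is again a formula,
-- and satisfaction of the translation is classical satisfaction of the original.
-- A decidable relation that is classically definable is thus also definable
-- with respect to _⊨_[_].
infix 2 _⊨_[_]
_⊨_[_] : ∀ (M : Structure) {n} → Formula n → Vec (Carrier M) n → Set
M ⊨ s ≐ t [ ρ ] = eval M s ρ ≡ eval M t ρ
M ⊨ s ≼ t [ ρ ] = le M (eval M s ρ) (eval M t ρ)
M ⊨ ⊥′    [ ρ ] = ⊥
M ⊨ φ ∧ ψ [ ρ ] = (M ⊨ φ [ ρ ]) × (M ⊨ ψ [ ρ ])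
M ⊨ φ ∨ ψ [ ρ ] = (M ⊨ φ [ ρ ]) ⊎ (M ⊨ ψ [ ρ ])
M ⊨ φ ⇒ ψ [ ρ ] = (M ⊨ φ [ ρ ]) → (M ⊨ ψ [ ρ ])
M ⊨ ∀′ φ  [ ρ ] = ∀ a → M ⊨ φ [ a ∷ ρ ]
M ⊨ ∃′ φ  [ ρ ] = ∃ λ a → M ⊨ φ [ a ∷ ρ ]

⟨ℚ,·,≤⟩ : Structure
⟨ℚ,·,≤⟩ = record { Carrier = ℚ ; mul = ℚ._*_ ; le = ℚ._≤_ }

{-# OPTIONS --safe #-}
module Submission where

-- An Ehrenfeucht–Fraïssé game on G = ⟨ℚ⁺, ·, ≤⟩.  Call tuples p and q of positive
-- rationals (N, M)-similar when every qᵢ / pᵢ is an M-th power and the monomials of p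
-- with exponents at most N are ordered like those of q.  Put K = N!.  If p and q are
-- (2KN, KM)-similar, then every c has an answer d = c wᴹ making (c, p) and (d, q)
-- (N, M)-similar.  Indeed, each comparison between monomials of (c, p), raised to a
-- suitable power, locates cᴷ among quotients of monomials of p.  If cᴷ is such a
-- quotient, then d is forced, and it has the form c wᴹ because corresponding quotients
-- differ by a KM-th power.  Otherwise wᴷᴹ only has to lie in an open interval, and
-- KM-th powers are dense.  So for each formula some (N, M)-similarity preserves its
-- truth; signs are carried along unchanged.  But (1, 1, 2) is (N, M)-similar to
-- (1, 1, 2ᴹ⁺¹), and 1 + 1 ≠ 2ᴹ⁺¹.

open import Algebra.Bundles using (AbelianGroup)
import Algebra.Definitions.RawMonoid as Multiple
import Algebra.Properties.CommutativeMonoid.Mult as Mult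
import Algebra.Properties.CommutativeSemigroup as CommutativeSemigroupProperties
import Algebra.Properties.Group as GroupProperties
open import Algebra.Structures using (IsAbelianGroup)
open import Data.Fin.Base using (Fin; zero; suc)
open import Data.Integer.Base as ℤ using (+_; -[1+_]; -<+; +<+)
import Data.Integer.Properties as ℤₚ
open import Data.Integer.Tactic.RingSolver using (solve-∀)
open import Data.List.Base as List using (List; []; _∷_)
open import Data.List.Membership.Propositional using (_∈_; find; lose)
open import Data.List.Membership.Propositional.Properties
  using (∈-cartesianProductWith⁺; ∈-cartesianProductWith⁻; ∈-cartesianProduct⁺;
         ∈-cartesianProduct⁻; ∈-upTo⁺; ∈-upTo⁻; ∈-map∘filter⁺; ∈-map∘filter⁻)
open import Data.List.Relation.Unary.Any using (any?; here; there)
open import Data.Nat.Base as ℕ using (ℕ; zero; suc; NonZero; _≤_; z≤n; s≤s; _!)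
open import Data.Nat.Coprimality as Coprimality using (1-coprimeTo)
open import Data.Nat.Divisibility using (_∣_; divides; m∣m*n; n∣m*n; m≤n⇒m!∣n!; ∣-trans)
import Data.Nat.Properties as ℕₚ
open import Data.Product.Base using (∃; _×_; _,_; proj₁; proj₂; -,_)
open import Data.Rational.Base as ℚ using (ℚ; mkℚ; 0ℚ; 1ℚ; Positive; *<*; _+_; _*_; _-_)
import Data.Rational.Properties as ℚₚ
import Data.Rational.Unnormalised.Base as ℚᵘ
import Data.Rational.Unnormalised.Properties as ℚᵘₚ
open import Data.Sum.Base as Sum using (inj₁; inj₂)
open import Data.Vec.Base as Vec
  using (Vec; []; _∷_; _++_; lookup; replicate; zipWith; _[_]≔_)
open import Data.Vec.Properties using (lookup-zipWith)
open import Data.Vec.Relation.Binary.Pointwise.Inductive as Pointwise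
  using (Pointwise; []; _∷_)
open import Data.Vec.Relation.Unary.All as All using (All; []; _∷_)
import Data.Vec.Relation.Unary.All.Properties as Allₚ
open import Function.Base using (_∘_)
open import Function.Bundles using (_⇔_; module Equivalence)
open import Relation.Binary.Core using (Rel)
open import Relation.Binary.Definitions using (Trichotomous; tri<; tri≈; tri>)
open import Relation.Binary.PropositionalEquality
  using (_≡_; refl; sym; trans; cong; cong₂; subst; subst₂; isEquivalence; module ≡-Reasoning)
open import Relation.Binary.Structures using (IsStrictTotalOrder)
open import Relation.Nullary.Decidable.Core using (yes; no)
open import Relation.Nullary.Negation.Core using (¬_; contradiction)
open import Relation.Unary using (Decidable)
open import Defs

-- Signs and bounded exponent vectors.

data Sgn : Set where
  ⊖ ○ ⊕ : Sgn

opposite : Sgn → Sgn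
opposite ⊖ = ⊕
opposite ○ = ○
opposite ⊕ = ⊖

bounded-mono : ∀ {N N′ n} {u : Vec ℕ n} → N ≤ N′ → All (_≤ N) u → All (_≤ N′) u
bounded-mono N≤N′ = All.map λ k≤N → ℕₚ.≤-trans k≤N N≤N′

-- Enumerating the exponent vectors makes the search for a multiplicative relation decidable and
-- leaves only finitely many bounds on a new coordinate.
boundedVectors : ℕ → ∀ n → List (Vec ℕ n)
boundedVectors N zero    = [] ∷ []
boundedVectors N (suc n) =
  List.cartesianProductWith _∷_ (List.upTo (suc N)) (boundedVectors N n)

∈-boundedVectors⁺ : ∀ {N n} {u : Vec ℕ n} → All (_≤ N) u → u ∈ boundedVectors N n
∈-boundedVectors⁺ []       = here refl
∈-boundedVectors⁺ (k≤N ∷ u≤N) =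
  ∈-cartesianProductWith⁺ _∷_ (∈-upTo⁺ (s≤s k≤N)) (∈-boundedVectors⁺ u≤N)

∈-boundedVectors⁻ : ∀ {N n} {u : Vec ℕ n} → u ∈ boundedVectors N n → All (_≤ N) u
∈-boundedVectors⁻ {n = zero}  {[]} _ = []
∈-boundedVectors⁻ {N} {suc n} u∈
  with ∈-cartesianProductWith⁻ _∷_ (List.upTo (suc N)) (boundedVectors N n) u∈
... | _ , _ , k∈ , u∈′ , refl = ℕₚ.≤-pred (∈-upTo⁻ k∈) ∷ ∈-boundedVectors⁻ u∈′

-- Dense Archimedean ordered abelian groups.

record DenseArchimedeanGroup : Set₁ where
  infixl 7 _∙_
  infix  9 _⁻¹
  infix  4 _<_
  field
    Carrier            : Set
    _<_                : Rel Carrier _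
    _∙_                : Carrier → Carrier → Carrier
    ε                  : Carrier
    _⁻¹                : Carrier → Carrier
    isAbelianGroup     : IsAbelianGroup _≡_ _∙_ ε _⁻¹
    isStrictTotalOrder : IsStrictTotalOrder _≡_ _<_
    ∙-monoʳ-<          : ∀ x {y z} → y < z → x ∙ y < x ∙ z
    <-dense            : ∀ {x y} → x < y → ∃ λ z → (x < z) × (z < y)
    nontrivial         : ∃ (ε <_)

  abelianGroup : AbelianGroup _ _
  abelianGroup = record { isAbelianGroup = isAbelianGroup }

  -- n • x is the power written xⁿ in the header.
  infixr 8 _•_
  _•_ : ℕ → Carrier → Carrier
  _•_ = Multiple._×_ (AbelianGroup.rawMonoid abelianGroup)

  field
    archimedean        : ∀ {x} y → ε < x → ∃ λ n → y < n • x

module DenseArchimedeanGroupProperties (G : DenseArchimedeanGroup) where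
  open DenseArchimedeanGroup G
  open IsStrictTotalOrder isStrictTotalOrder public
    using (compare; _≟_; _<?_) renaming (trans to <-trans; irrefl to <-irrefl; asym to <-asym)
  open AbelianGroup abelianGroup public
    using (assoc; comm; identityˡ; identityʳ; inverseʳ;
           group; commutativeMonoid; commutativeSemigroup)
  open Mult commutativeMonoid public
    using ()
    renaming (×-homo-+ to •-homo-+; ×-homo-1 to •-homo-1; ×-assocˡ to •-assocˡ;
              ×-distrib-+ to •-distrib-∙)
  open CommutativeSemigroupProperties commutativeSemigroup
    using (interchange; x∙yz≈y∙xz; xy∙z≈xz∙y)
  open GroupProperties group using (\\-leftDividesˡ)

  private variable
    x x′ y y′ z b : Carrier
    n : ℕ

  -- Order

  ∙-monoˡ-< : ∀ x → y < z → y ∙ x < z ∙ x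
  ∙-monoˡ-< x y<z = subst₂ _<_ (comm x _) (comm x _) (∙-monoʳ-< x y<z)

  ∙-mono-< : x < x′ → y < y′ → x ∙ y < x′ ∙ y′
  ∙-mono-< {x} x<x′ y<y′ = <-trans (∙-monoʳ-< x y<y′) (∙-monoˡ-< _ x<x′)

  StrictlyIncreasing : (Carrier → Carrier) → Set
  StrictlyIncreasing f = ∀ {x y} → x < y → f x < f y

  cancel-< : ∀ {f} → StrictlyIncreasing f → f x < f y → x < y
  cancel-< {x} {y} mono fx<fy with compare x y
  ... | tri< x<y _ _  = x<y
  ... | tri≈ _ refl _ = contradiction fx<fy (<-irrefl refl)
  ... | tri> _ _ y<x  = contradiction fx<fy (<-asym (mono y<x))

  ∙-cancelˡ-< : ∀ x → x ∙ y < x ∙ z → y < z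
  ∙-cancelˡ-< x = cancel-< (∙-monoʳ-< x)

  •-monoʳ-< : ∀ n .{{_ : NonZero n}} → StrictlyIncreasing (n •_)
  •-monoʳ-< (suc zero)    x<y = subst₂ _<_ (sym (identityʳ _)) (sym (identityʳ _)) x<y
  •-monoʳ-< (suc (suc n)) x<y = ∙-mono-< x<y (•-monoʳ-< (suc n) x<y)

  •-zeroʳ : ∀ n → n • ε ≡ ε
  •-zeroʳ zero    = refl
  •-zeroʳ (suc n) = trans (identityˡ _) (•-zeroʳ n)

  •-positive : ∀ n .{{_ : NonZero n}} → ε < x → ε < n • x
  •-positive {x} n ε<x = subst (_< n • x) (•-zeroʳ n) (•-monoʳ-< n ε<x)

  •-swap : ∀ m n x → m • n • x ≡ n • m • x
  •-swap m n x = begin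
    m • n • x       ≡⟨ •-assocˡ x m n ⟩
    (m ℕ.* n) • x   ≡⟨ cong (_• x) (ℕₚ.*-comm m n) ⟩
    (n ℕ.* m) • x   ≡⟨ •-assocˡ x n m ⟨
    n • m • x       ∎
    where open ≡-Reasoning

  x<x∙y : ∀ x → ε < y → x < x ∙ y
  x<x∙y {y} x ε<y = subst (_< x ∙ y) (identityʳ x) (∙-monoʳ-< x ε<y)

  ∃-above : ∀ x → ∃ (x <_)
  ∃-above x = -, x<x∙y x (proj₂ nontrivial)

  ∃-below : ∀ x → ∃ (_< x)
  ∃-below x = (proj₁ nontrivial ⁻¹) ∙ x ,
    ∙-cancelˡ-< (proj₁ nontrivial)
      (subst₂ _<_ (sym (\\-leftDividesˡ _ x)) (comm x _) (x<x∙y x (proj₂ nontrivial)))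

  \\-<⁺ : ∀ a → b < a ∙ x → a ⁻¹ ∙ b < x
  \\-<⁺ a = ∙-cancelˡ-< a ∘ subst (_< _) (sym (\\-leftDividesˡ a _))

  <-\\⁺ : ∀ a → a ∙ x < b → x < a ⁻¹ ∙ b
  <-\\⁺ a = ∙-cancelˡ-< a ∘ subst (_ <_) (sym (\\-leftDividesˡ a _))

  \\-<⁻ : ∀ a → a ⁻¹ ∙ b < x → b < a ∙ x
  \\-<⁻ a = subst (_< _) (\\-leftDividesˡ a _) ∘ ∙-monoʳ-< a

  <-\\⁻ : ∀ a → x < a ⁻¹ ∙ b → a ∙ x < b
  <-\\⁻ a = subst (_ <_) (\\-leftDividesˡ a _) ∘ ∙-monoʳ-< a

  fraction-< : ∀ a a′ {b b′} → b ∙ a′ < a ∙ b′ → a ⁻¹ ∙ b < a′ ⁻¹ ∙ b′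
  fraction-< a a′ {b} {b′} ba′<ab′ = \\-<⁺ a (∙-cancelˡ-< a′ (subst₂ _<_ (comm b a′)
    (trans (cong (a ∙_) (sym (\\-leftDividesˡ a′ b′))) (x∙yz≈y∙xz a a′ _)) ba′<ab′))

  -- Cuts between finite sets

  _<ᴸ_ : List Carrier → Carrier → Set
  ls <ᴸ x = ∀ {l} → l ∈ ls → l < x

  _<ᴿ_ : Carrier → List Carrier → Set
  x <ᴿ rs = ∀ {r} → r ∈ rs → x < r

  -- A point found for the tail is kept if it already exceeds the head; otherwise density supplies
  -- one between the head and `y`.
  squeeze : ∀ ls → ls <ᴸ y → ∃ λ z → (ls <ᴸ z) × (z < y)
  squeeze []       _    = proj₁ (∃-below _) , (λ ()) , proj₂ (∃-below _)
  squeeze (l ∷ ls) ls<y with squeeze ls (ls<y ∘ there)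
  ... | z , ls<z , z<y with compare l z
  ...   | tri< l<z _ _ = z , (λ { (here refl) → l<z ; (there m) → ls<z m }) , z<y
  ...   | tri≈ _ refl _ =
          let w , l<w , w<y = <-dense z<y in
          w , (λ { (here refl) → l<w ; (there m) → <-trans (ls<z m) l<w }) , w<y
  ...   | tri> _ _ z<l =
          let w , l<w , w<y = <-dense (ls<y (here refl)) in
          w , (λ { (here refl) → l<w ; (there m) → <-trans (<-trans (ls<z m) z<l) l<w }) , w<y

  ∃-aboveᴸ : ∀ ls → ∃ (ls <ᴸ_)
  ∃-aboveᴸ []       = ε , λ ()
  ∃-aboveᴸ (l ∷ ls) with ∃-aboveᴸ ls
  ... | z , ls<z with l <? z | ∃-above l
  ...   | yes l<z | _ = z , λ { (here refl) → l<z ; (there m) → ls<z m }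
  ...   | no  l≮z | w , l<w = w , λ { (here refl) → l<w ; (there m) → ≮-<-trans m }
    where
    ≮-<-trans : ∀ {k} → k ∈ ls → k < w
    ≮-<-trans {k} m with compare l z
    ... | tri< l<z _ _  = contradiction l<z l≮z
    ... | tri≈ _ refl _ = <-trans (ls<z m) l<w
    ... | tri> _ _ z<l  = <-trans (<-trans (ls<z m) z<l) l<w

  -- Induction on `rs`: of the point found for the tail and a point squeezed below the head, the
  -- smaller lies below all of `r ∷ rs`, and both lie above `ls`.
  cut : ∀ ls rs → (∀ {l r} → l ∈ ls → r ∈ rs → l < r) → ∃ λ x → (ls <ᴸ x) × (x <ᴿ rs)
  cut ls []       _     = let x , ls<x = ∃-aboveᴸ ls in x , ls<x , λ ()
  cut ls (r ∷ rs) ls<rs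
    with cut ls rs (λ l∈ r∈ → ls<rs l∈ (there r∈)) | squeeze ls (λ l∈ → ls<rs l∈ (here refl))
  ... | x , ls<x , x<rs | z , ls<z , z<r with compare x z
  ...   | tri< x<z _ _  = x , ls<x , λ { (here refl) → <-trans x<z z<r ; (there m) → x<rs m }
  ...   | tri≈ _ refl _ = x , ls<x , λ { (here refl) → z<r ; (there m) → x<rs m }
  ...   | tri> _ _ z<x  = z , ls<z , λ { (here refl) → z<r ; (there m) → <-trans z<x (x<rs m) }

  -- Density of the multiples of M

  -- Continuity of `M •_` at `ε`. In the step, `y` is the product of `h` and `h ⁻¹ ∙ y`, both above
  -- `ε`: the first bounds `M • x`, the second bounds `x`.
  ∃-bound-• : ∀ M → ε < y → ∃ λ b → (ε < b) × (∀ {x} → x < b → M • x < y)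
  ∃-bound-• {y} zero    ε<y = y , ε<y , λ _ → ε<y
  ∃-bound-• {y} (suc M) ε<y =
    let h , ε<h , h<y   = <-dense ε<y
        b , ε<b , bound = ∃-bound-• M ε<h
        m , ε<m , m<    = cut (ε ∷ []) (b ∷ h ⁻¹ ∙ y ∷ []) λ
          { (here refl) (here refl)         → ε<b
          ; (here refl) (there (here refl)) → <-\\⁺ h (subst (_< y) (sym (identityʳ h)) h<y) }
    in m , ε<m (here refl) , λ x<m →
         subst (_ <_) (trans (comm _ h) (\\-leftDividesˡ h y))
           (∙-mono-< (<-trans x<m (m< (there (here refl)))) (bound (<-trans x<m (m< (here refl)))))

  -- Downward search from a multiple that overshoots `z`; it cannot run past zero, because `z` is
  -- above `ε`.
  crossing : ∀ k → ε < z → z < k • x → ∃ λ j → ¬ (z < j • x) × (z < suc j • x)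
  crossing         zero    ε<z z<ε = contradiction z<ε (<-asym ε<z)
  crossing {z} {x} (suc k) ε<z z<  with z <? k • x
  ... | yes z<kx = crossing k ε<z z<kx
  ... | no  z≮kx = k , z≮kx , z<

  -- The multiples of M • r advance by less than x ⁻¹ ∙ y, so the first above x is below y.
  multiples-dense⁺ : ∀ M .{{_ : NonZero M}} → ε < x → x < y → ∃ λ w → (x < M • w) × (M • w < y)
  multiples-dense⁺ {x} {y} M ε<x x<y =
    let b , ε<b , bound = ∃-bound-• M (<-\\⁺ x (subst (_< y) (sym (identityʳ x)) x<y))
        r , ε<r , r<b   = <-dense ε<b
        k , x<kMr       = archimedean x (•-positive M ε<r)
        j , x≮jMr , x<  = crossing k ε<x x<kMr
    in suc j • r
     , subst (x <_) (•-swap (suc j) M r) x<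
     , subst (_< y) (•-swap (suc j) M r) (step (bound r<b) x≮jMr)
    where
    step : ∀ {s t} → s < x ⁻¹ ∙ y → ¬ (x < t) → s ∙ t < y
    step {s} {t} s< x≮t with compare x t
    ... | tri< x<t _ _  = contradiction x<t x≮t
    ... | tri≈ _ refl _ = subst (_< y) (comm x s) (<-\\⁻ x s<)
    ... | tri> _ _ t<x  = subst (_< y) (comm t s) (<-trans (∙-monoˡ-< s t<x) (<-\\⁻ x s<))

  -- Reduction to endpoints above `ε`: both are moved up by a large `shift`, which is itself a
  -- multiple of `M` and so can be divided out of the answer.
  multiples-dense : ∀ M .{{_ : NonZero M}} → x < y → ∃ λ w → (x < M • w) × (M • w < y)
  multiples-dense {x} {y} M x<y =
    let t , ε<t   = nontrivial
        n , x⁻¹<  = archimedean (x ⁻¹) (•-positive M ε<t)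
        shift     = n • M • t
        w , lo , hi = multiples-dense⁺ M
          (subst₂ _<_ (inverseʳ x) (comm x shift) (∙-monoʳ-< x x⁻¹<)) (∙-monoʳ-< shift x<y)
        w′        = (n • t) ⁻¹ ∙ w
        eq : shift ∙ M • w′ ≡ M • w
        eq = trans (cong (_∙ M • w′) (•-swap n M t))
               (trans (sym (•-distrib-∙ (n • t) w′ M))
                      (cong (M •_) (\\-leftDividesˡ (n • t) w)))
    in w′ , ∙-cancelˡ-< shift (subst (_ <_) (sym eq) lo)
          , ∙-cancelˡ-< shift (subst (_< _) (sym eq) hi)

  -- Comparison

  -- With values in `Sgn`, agreement of two orderings becomes an equation, which can be chained and
  -- rewritten.
  cmp : Carrier → Carrier → Sgn
  cmp x y with compare x y
  ... | tri< _ _ _ = ⊖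
  ... | tri≈ _ _ _ = ○
  ... | tri> _ _ _ = ⊕

  <⇒cmp : x < y → cmp x y ≡ ⊖
  <⇒cmp {x} {y} x<y with compare x y
  ... | tri< _ _ _ = refl
  ... | tri≈ x≮y _ _ = contradiction x<y x≮y
  ... | tri> x≮y _ _ = contradiction x<y x≮y

  ≡⇒cmp : x ≡ y → cmp x y ≡ ○
  ≡⇒cmp {x} {y} x≡y with compare x y
  ... | tri< _ x≢y _ = contradiction x≡y x≢y
  ... | tri≈ _ _ _ = refl
  ... | tri> _ x≢y _ = contradiction x≡y x≢y

  >⇒cmp : y < x → cmp x y ≡ ⊕
  >⇒cmp {y} {x} y<x with compare x y
  ... | tri< _ _ y≮x = contradiction y<x y≮x
  ... | tri≈ _ _ y≮x = contradiction y<x y≮x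
  ... | tri> _ _ _ = refl

  cmp⇒< : cmp x y ≡ ⊖ → x < y
  cmp⇒< {x} {y} eq with compare x y
  cmp⇒< eq | tri< x<y _ _ = x<y

  cmp-swap : ∀ x y → cmp x y ≡ opposite (cmp y x)
  cmp-swap x y with compare y x
  ... | tri< y<x _ _ = >⇒cmp y<x
  ... | tri≈ _ y≡x _ = ≡⇒cmp (sym y≡x)
  ... | tri> _ _ x<y = <⇒cmp x<y

  cmp-mono : ∀ {f} → StrictlyIncreasing f → ∀ x y → cmp (f x) (f y) ≡ cmp x y
  cmp-mono {f} mono x y with compare x y
  ... | tri< x<y _ _ = <⇒cmp (mono x<y)
  ... | tri≈ _ x≡y _ = ≡⇒cmp (cong f x≡y)
  ... | tri> _ _ y<x = >⇒cmp (mono y<x)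

  -- Monomials

  -- The monomial in `p` with exponent vector `u`. Exponents are natural numbers, so a quotient of
  -- monomials is represented by a pair of vectors.
  infixr 8 _⊙_
  _⊙_ : Vec ℕ n → Vec Carrier n → Carrier
  []      ⊙ []      = ε
  (k ∷ u) ⊙ (x ∷ p) = k • x ∙ u ⊙ p

  ⊙-homo-+ : ∀ (u v : Vec ℕ n) p → zipWith ℕ._+_ u v ⊙ p ≡ u ⊙ p ∙ v ⊙ p
  ⊙-homo-+ []      []      []      = sym (identityˡ ε)
  ⊙-homo-+ (k ∷ u) (l ∷ v) (x ∷ p) =
    trans (cong₂ _∙_ (•-homo-+ x k l) (⊙-homo-+ u v p)) (interchange _ _ _ _)

  ⊙-homo-* : ∀ f (u : Vec ℕ n) p → Vec.map (f ℕ.*_) u ⊙ p ≡ f • (u ⊙ p)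
  ⊙-homo-* f []      []      = sym (•-zeroʳ f)
  ⊙-homo-* f (k ∷ u) (x ∷ p) =
    trans (cong₂ _∙_ (sym (•-assocˡ x f k)) (⊙-homo-* f u p)) (sym (•-distrib-∙ _ _ f))

  ⊙-zero : ∀ (p : Vec Carrier n) → replicate n 0 ⊙ p ≡ ε
  ⊙-zero []      = refl
  ⊙-zero (x ∷ p) = trans (identityˡ _) (⊙-zero p)

  -- Similar tuples

  -- A record because M cannot be inferred from the equation: M • g is stuck, not injective.
  infix 4 _≡_mod_
  record _≡_mod_ (y x : Carrier) (M : ℕ) : Set where
    constructor _,_
    field
      multiplier : Carrier
      equation   : y ≡ x ∙ M • multiplier

  -- The multiples of `M` form a subgroup, so congruence passes to products and powers.
  ⊙-mod : ∀ {M} {p q : Vec Carrier n} u →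
          Pointwise (λ x y → y ≡ x mod M) p q → u ⊙ q ≡ u ⊙ p mod M
  ⊙-mod {M = M} [] [] = ε , sym (trans (identityˡ _) (•-zeroʳ M))
  ⊙-mod {M = M} {x ∷ p} {y ∷ q} (k ∷ u) ((g , y≡) ∷ ps) =
    let h , eq = ⊙-mod u ps in k • g ∙ h , (begin
      k • y ∙ u ⊙ q                            ≡⟨ cong₂ (λ y z → k • y ∙ z) y≡ eq ⟩
      k • (x ∙ M • g) ∙ (u ⊙ p ∙ M • h)        ≡⟨ cong (_∙ (u ⊙ p ∙ M • h)) (•-distrib-∙ x (M • g) k) ⟩
      k • x ∙ k • M • g ∙ (u ⊙ p ∙ M • h)      ≡⟨ interchange _ _ _ _ ⟩
      k • x ∙ u ⊙ p ∙ (k • M • g ∙ M • h)      ≡⟨ cong (λ z → k • x ∙ u ⊙ p ∙ (z ∙ M • h)) (•-swap k M g) ⟩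
      k • x ∙ u ⊙ p ∙ (M • k • g ∙ M • h)      ≡⟨ cong (k • x ∙ u ⊙ p ∙_) (•-distrib-∙ (k • g) h M) ⟨
      k • x ∙ u ⊙ p ∙ M • (k • g ∙ h)          ∎)
    where open ≡-Reasoning

  record Similar (N M : ℕ) {n} (p q : Vec Carrier n) : Set where
    field
      shift : Pointwise (λ x y → y ≡ x mod M) p q
      order : ∀ {u v} → All (_≤ N) u → All (_≤ N) v →
              cmp (u ⊙ p) (v ⊙ p) ≡ cmp (u ⊙ q) (v ⊙ q)

  open Similar public

  mod-sym : ∀ {M} → y ≡ x mod M → x ≡ y mod M
  mod-sym {y} {x} {M} (g , y≡) = g ⁻¹ , sym (begin
    y ∙ M • g ⁻¹               ≡⟨ cong (_∙ M • g ⁻¹) y≡ ⟩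
    x ∙ M • g ∙ M • g ⁻¹       ≡⟨ assoc _ _ _ ⟩
    x ∙ (M • g ∙ M • g ⁻¹)     ≡⟨ cong (x ∙_) (•-distrib-∙ g (g ⁻¹) M) ⟨
    x ∙ M • (g ∙ g ⁻¹)         ≡⟨ cong (λ e → x ∙ M • e) (inverseʳ g) ⟩
    x ∙ M • ε                  ≡⟨ cong (x ∙_) (•-zeroʳ M) ⟩
    x ∙ ε                      ≡⟨ identityʳ x ⟩
    x                          ∎)
    where open ≡-Reasoning

  mod-∣ : ∀ {M M′} → M′ ∣ M → y ≡ x mod M → y ≡ x mod M′
  mod-∣ {y} {x} {_} {M′} (divides k refl) (g , y≡) =
    k • g , trans y≡ (cong (x ∙_) (trans (cong (_• g) (ℕₚ.*-comm k M′)) (sym (•-assocˡ g M′ k))))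

  Similar-sym : ∀ {N M} {p q : Vec Carrier n} → Similar N M p q → Similar N M q p
  Similar-sym S = record
    { shift = Pointwise.sym mod-sym (shift S)
    ; order = λ u≤ v≤ → sym (order S u≤ v≤)
    }

  Similar-weaken : ∀ {N N′ M M′} {p q : Vec Carrier n} →
                   N′ ≤ N → M′ ∣ M → Similar N M p q → Similar N′ M′ p q
  Similar-weaken N′≤N M′∣M S = record
    { shift = Pointwise.map (mod-∣ M′∣M) (shift S)
    ; order = λ u≤ v≤ → order S (bounded-mono N′≤N u≤) (bounded-mono N′≤N v≤)
    }

  -- Extending similar tuples by a new coordinate.

  module _ {L K M} .{{_ : NonZero K}} .{{_ : NonZero M}} {p q : Vec Carrier n}
           (S : Similar (L ℕ.+ L) (K ℕ.* M) p q) (c : Carrier) where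

    private
      Bounded : Vec ℕ n → Set
      Bounded = All (_≤ L)

      bounded-+ : ∀ {u v} → Bounded u → Bounded v → All (_≤ L ℕ.+ L) (zipWith ℕ._+_ u v)
      bounded-+ = All.zipWith ℕₚ.+-mono-≤

      -- Comparing two quotients by cross-multiplication adds exponent vectors; this is what the
      -- doubled bound `L + L` pays for.
      order₂ : ∀ {u v u′ v′} → Bounded u → Bounded v → Bounded u′ → Bounded v′ →
               cmp (u ⊙ p ∙ v ⊙ p) (u′ ⊙ p ∙ v′ ⊙ p) ≡ cmp (u ⊙ q ∙ v ⊙ q) (u′ ⊙ q ∙ v′ ⊙ q)
      order₂ {u} {v} {u′} {v′} u≤ v≤ u′≤ v′≤ = begin
        cmp (u ⊙ p ∙ v ⊙ p) (u′ ⊙ p ∙ v′ ⊙ p)  ≡⟨ cong₂ cmp (⊙-homo-+ u v p) (⊙-homo-+ u′ v′ p) ⟨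
        _                                      ≡⟨ order S (bounded-+ u≤ v≤) (bounded-+ u′≤ v′≤) ⟩
        _                                      ≡⟨ cong₂ cmp (⊙-homo-+ u v q) (⊙-homo-+ u′ v′ q) ⟩
        cmp (u ⊙ q ∙ v ⊙ q) (u′ ⊙ q ∙ v′ ⊙ q)  ∎
        where open ≡-Reasoning

      pairs : List (Vec ℕ n × Vec ℕ n)
      pairs = List.cartesianProduct (boundedVectors L n) (boundedVectors L n)

      ∈-pairs⁺ : ∀ {u v} → Bounded u → Bounded v → (u , v) ∈ pairs
      ∈-pairs⁺ u≤ v≤ = ∈-cartesianProduct⁺ (∈-boundedVectors⁺ u≤) (∈-boundedVectors⁺ v≤)

      ∈-pairs⁻ : ∀ {u v} → (u , v) ∈ pairs → Bounded u × Bounded v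
      ∈-pairs⁻ uv∈ =
        let u∈ , v∈ = ∈-cartesianProduct⁻ (boundedVectors L n) (boundedVectors L n) uv∈ in
        ∈-boundedVectors⁻ u∈ , ∈-boundedVectors⁻ v∈

    -- Only the exponent `K` of the new coordinate is treated here; `cmp-clear` reduces smaller
    -- positive exponents to it.
    Aligned : Carrier → Set
    Aligned d = ∀ {u v} → Bounded u → Bounded v →
                cmp (u ⊙ p ∙ K • c) (v ⊙ p) ≡ cmp (u ⊙ q ∙ K • d) (v ⊙ q)

    align-dependent : ∀ {u v} → Bounded u → Bounded v → u ⊙ p ∙ K • c ≡ v ⊙ p →
                      ∃ λ d → (d ≡ c mod M) × Aligned d
    align-dependent {u} {v} u≤ v≤ rel =
      let a , u≡ = ⊙-mod u (shift S)
          b , v≡ = ⊙-mod v (shift S)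
          -- Passing from `p` to `q` multiplies the quotient of `v` by `u` by
          -- `(K * M) • (a ⁻¹ ∙ b)`. Since `rel` makes this quotient `K • c`, changing `c` by
          -- `M • g` keeps the relation.
          g      = a ⁻¹ ∙ b
          d      = c ∙ M • g
          rel′ : u ⊙ q ∙ K • d ≡ v ⊙ q
          rel′ = begin
            u ⊙ q ∙ K • d
              ≡⟨ cong₂ _∙_ u≡ (•-distrib-∙ c (M • g) K) ⟩
            u ⊙ p ∙ (K ℕ.* M) • a ∙ (K • c ∙ K • M • g)
              ≡⟨ interchange _ _ _ _ ⟩
            u ⊙ p ∙ K • c ∙ ((K ℕ.* M) • a ∙ K • M • g)
              ≡⟨ cong₂ (λ x y → x ∙ ((K ℕ.* M) • a ∙ y)) rel (•-assocˡ g K M) ⟩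
            v ⊙ p ∙ ((K ℕ.* M) • a ∙ (K ℕ.* M) • g)
              ≡⟨ cong (v ⊙ p ∙_) (•-distrib-∙ a g (K ℕ.* M)) ⟨
            v ⊙ p ∙ (K ℕ.* M) • (a ∙ g)
              ≡⟨ cong (λ x → v ⊙ p ∙ (K ℕ.* M) • x) (\\-leftDividesˡ a b) ⟩
            v ⊙ p ∙ (K ℕ.* M) • b
              ≡⟨ v≡ ⟨
            v ⊙ q ∎
      in d , (g , refl) , λ {u′} {v′} u′≤ v′≤ → begin
        cmp (u′ ⊙ p ∙ K • c) (v′ ⊙ p)
          -- After multiplication by `u ⊙ p`, the relation replaces `c` by `v ⊙ p`; the resulting
          -- comparison of monomials of `p` alone can be moved to `q`.
          ≡⟨ cmp-mono (∙-monoʳ-< (u ⊙ p)) _ _ ⟨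
        cmp (u ⊙ p ∙ (u′ ⊙ p ∙ K • c)) (u ⊙ p ∙ v′ ⊙ p)
          ≡⟨ cong (λ x → cmp x (u ⊙ p ∙ v′ ⊙ p)) (trans (x∙yz≈y∙xz _ _ _) (cong (u′ ⊙ p ∙_) rel)) ⟩
        cmp (u′ ⊙ p ∙ v ⊙ p) (u ⊙ p ∙ v′ ⊙ p)
          ≡⟨ order₂ u′≤ v≤ u≤ v′≤ ⟩
        cmp (u′ ⊙ q ∙ v ⊙ q) (u ⊙ q ∙ v′ ⊙ q)
          ≡⟨ cong (λ x → cmp x (u ⊙ q ∙ v′ ⊙ q)) (trans (x∙yz≈y∙xz _ _ _) (cong (u′ ⊙ q ∙_) rel′)) ⟨
        cmp (u ⊙ q ∙ (u′ ⊙ q ∙ K • d)) (u ⊙ q ∙ v′ ⊙ q)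
          ≡⟨ cmp-mono (∙-monoʳ-< (u ⊙ q)) _ _ ⟩
        cmp (u′ ⊙ q ∙ K • d) (v′ ⊙ q) ∎
      where open ≡-Reasoning

    -- Every comparison is strict, so `w` is subject only to finitely many strict bounds on
    -- `(K * M) • w`.
    align-independent : (∀ {u v} → Bounded u → Bounded v → ¬ (u ⊙ p ∙ K • c ≡ v ⊙ p)) →
                        ∃ λ d → (d ≡ c mod M) × Aligned d
    align-independent indep =
      let w , ls<w , w<rs = root in c ∙ M • w , (w , refl) , aligned ls<w w<rs
      where
      -- The value of `(K * M) • w` at which `u ⊙ q ∙ K • (c ∙ M • w)` would equal `v ⊙ q`.
      ratio : Vec ℕ n × Vec ℕ n → Carrier
      ratio (u , v) = (u ⊙ q ∙ K • c) ⁻¹ ∙ v ⊙ q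

      lower? : Decidable λ (u , v) → v ⊙ p < u ⊙ p ∙ K • c
      lower? (u , v) = v ⊙ p <? u ⊙ p ∙ K • c

      upper? : Decidable λ (u , v) → u ⊙ p ∙ K • c < v ⊙ p
      upper? (u , v) = u ⊙ p ∙ K • c <? v ⊙ p

      lowers uppers : List Carrier
      lowers = List.map ratio (List.filter lower? pairs)
      uppers = List.map ratio (List.filter upper? pairs)

      lowers<uppers : ∀ {l r} → l ∈ lowers → r ∈ uppers → l < r
      lowers<uppers l∈ r∈ with ∈-map∘filter⁻ ratio lower? l∈ | ∈-map∘filter⁻ ratio upper? r∈
      ... | (u , v) , uv∈ , refl , v<uc | (u′ , v′) , uv′∈ , refl , u′c<v′ =
        let u≤ , v≤ = ∈-pairs⁻ uv∈
            u′≤ , v′≤ = ∈-pairs⁻ uv′∈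
            -- Chaining the two inequalities through `c` eliminates it, so that `order₂` applies.
            p-ineq : v ⊙ p ∙ u′ ⊙ p < u ⊙ p ∙ v′ ⊙ p
            p-ineq = <-trans (∙-monoˡ-< (u′ ⊙ p) v<uc)
              (subst (_< u ⊙ p ∙ v′ ⊙ p) (trans (x∙yz≈y∙xz _ _ _) (comm _ _))
                     (∙-monoʳ-< (u ⊙ p) u′c<v′))
            q-ineq : v ⊙ q ∙ u′ ⊙ q < u ⊙ q ∙ v′ ⊙ q
            q-ineq = cmp⇒< (trans (sym (order₂ v≤ u′≤ u≤ v′≤)) (<⇒cmp p-ineq))
        in fraction-< _ _ (subst₂ _<_ (assoc _ _ _) (xy∙z≈xz∙y _ _ _) (∙-monoˡ-< (K • c) q-ineq))

      -- A single cut gives one point; a second cut above it opens an interval wide enough to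
      -- contain a multiple of `K * M`.
      bounds : ∃ λ x → ∃ λ y → (lowers <ᴸ x) × (x < y) × (y <ᴿ uppers)
      bounds with cut lowers uppers lowers<uppers
      ... | x , ls<x , x<rs with cut (x ∷ []) uppers (λ { (here refl) → x<rs })
      ...   | y , x<y , y<rs = x , y , ls<x , x<y (here refl) , y<rs

      instance
        K*M≢0 : NonZero (K ℕ.* M)
        K*M≢0 = ℕₚ.m*n≢0 K M

      root : ∃ λ w → (lowers <ᴸ ((K ℕ.* M) • w)) × (((K ℕ.* M) • w) <ᴿ uppers)
      root = let x , y , ls<x , x<y , y<rs = bounds
                 w , x<w , w<y = multiples-dense (K ℕ.* M) x<y
             in w , (λ l∈ → <-trans (ls<x l∈) x<w) , (λ r∈ → <-trans w<y (y<rs r∈))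

      Kd≡ : ∀ a w → a ∙ K • c ∙ (K ℕ.* M) • w ≡ a ∙ K • (c ∙ M • w)
      Kd≡ a w = trans (assoc _ _ _) (cong (a ∙_) (trans
        (cong (K • c ∙_) (sym (•-assocˡ w K M))) (sym (•-distrib-∙ c (M • w) K))))

      aligned : ∀ {w} → lowers <ᴸ ((K ℕ.* M) • w) → ((K ℕ.* M) • w) <ᴿ uppers →
                Aligned (c ∙ M • w)
      aligned {w} ls<w w<rs {u} {v} u≤ v≤ with compare (u ⊙ p ∙ K • c) (v ⊙ p)
      ... | tri< uc<v _ _ = sym (<⇒cmp (subst (_< v ⊙ q) (Kd≡ (u ⊙ q) w)
              (<-\\⁻ _ (w<rs (∈-map∘filter⁺ ratio upper? ((u , v) , ∈-pairs⁺ u≤ v≤ , refl , uc<v))))))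
      ... | tri≈ _ uc≡v _ = contradiction uc≡v (indep u≤ v≤)
      ... | tri> _ _ v<uc = sym (>⇒cmp (subst (v ⊙ q <_) (Kd≡ (u ⊙ q) w)
              (\\-<⁻ _ (ls<w (∈-map∘filter⁺ ratio lower? ((u , v) , ∈-pairs⁺ u≤ v≤ , refl , v<uc))))))

    align : ∃ λ d → (d ≡ c mod M) × Aligned d
    align with any? (λ (u , v) → u ⊙ p ∙ K • c ≟ v ⊙ p) pairs
    ... | no none = align-independent λ u≤ v≤ rel → none (lose (∈-pairs⁺ u≤ v≤) rel)
    ... | yes some with find some
    ...   | _ , uv∈ , rel = let u≤ , v≤ = ∈-pairs⁻ uv∈ in align-dependent u≤ v≤ rel

  -- Scaling by f brings the exponent e of the new coordinate c to the common value K.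
  cmp-clear : ∀ {K} e f .{{_ : NonZero f}} j → f ℕ.* e ≡ K → ∀ c a b →
              cmp ((e ℕ.+ j) • c ∙ a) (j • c ∙ b) ≡ cmp (f • a ∙ K • c) (f • b)
  cmp-clear {K} e f j fe≡K c a b = begin
    cmp ((e ℕ.+ j) • c ∙ a) (j • c ∙ b)     ≡⟨ cong (λ x → cmp x (j • c ∙ b)) regroup ⟩
    cmp (j • c ∙ (a ∙ e • c)) (j • c ∙ b)   ≡⟨ cmp-mono (∙-monoʳ-< (j • c)) _ _ ⟩
    cmp (a ∙ e • c) b                       ≡⟨ cmp-mono (•-monoʳ-< f) _ _ ⟨
    cmp (f • (a ∙ e • c)) (f • b)           ≡⟨ cong (λ x → cmp x (f • b)) clear ⟩
    cmp (f • a ∙ K • c) (f • b)             ∎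
    where
    open ≡-Reasoning
    regroup : (e ℕ.+ j) • c ∙ a ≡ j • c ∙ (a ∙ e • c)
    regroup = trans (cong (_∙ a) (trans (•-homo-+ c e j) (comm _ _)))
                    (trans (assoc _ _ _) (cong (j • c ∙_) (comm _ _)))
    clear : f • (a ∙ e • c) ≡ f • a ∙ K • c
    clear = trans (•-distrib-∙ a (e • c) f)
                  (cong (f • a ∙_) (trans (•-assocˡ c f e) (cong (_• c) fe≡K)))

  -- Clearing multiplies exponents up to `N` by a factor of at most `K`, whence `L = K * N`. The
  -- factor `K` in the old modulus allows a forced value of `K • d` to be divided by `K`.
  extend : ∀ N M .{{_ : NonZero M}} → let K = N ! ; L = K ℕ.* N in
           {p q : Vec Carrier n} → Similar (L ℕ.+ L) (K ℕ.* M) p q →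
           ∀ c → ∃ λ d → Similar N M (c ∷ p) (d ∷ q)
  extend N M {p} {q} S c = d , record
    { shift = d≡c ∷ Pointwise.map (mod-∣ (divides K refl)) (shift S)
    ; order = order′
    }
    where
    K = N !
    L = K ℕ.* N
    instance
      K≢0 : NonZero K
      K≢0 = N ℕₚ.!≢0

    aligning = align {L = L} {K} {M} S c
    d        = proj₁ aligning
    d≡c      = proj₁ (proj₂ aligning)
    aligned  = proj₂ (proj₂ aligning)

    N≤2L : N ≤ L ℕ.+ L
    N≤2L = ℕₚ.≤-trans (ℕₚ.m≤n*m N K) (ℕₚ.m≤m+n L L)

    -- Here `e` is the excess of the exponent of the new coordinate on the left over the one on the
    -- right.
    order-≥ : ∀ e j {u v} → e ≤ N → All (_≤ N) u → All (_≤ N) v →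
              cmp ((e ℕ.+ j) • c ∙ u ⊙ p) (j • c ∙ v ⊙ p)
              ≡ cmp ((e ℕ.+ j) • d ∙ u ⊙ q) (j • d ∙ v ⊙ q)
    -- Zero does not divide `K`, so nothing can be cleared; instead the new coordinate cancels.
    order-≥ zero j {u} {v} _ u≤ v≤ = begin
      cmp (j • c ∙ u ⊙ p) (j • c ∙ v ⊙ p)  ≡⟨ cmp-mono (∙-monoʳ-< (j • c)) _ _ ⟩
      cmp (u ⊙ p) (v ⊙ p)                  ≡⟨ order S (bounded-mono N≤2L u≤) (bounded-mono N≤2L v≤) ⟩
      cmp (u ⊙ q) (v ⊙ q)                  ≡⟨ cmp-mono (∙-monoʳ-< (j • d)) _ _ ⟨
      cmp (j • d ∙ u ⊙ q) (j • d ∙ v ⊙ q)  ∎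
      where open ≡-Reasoning
    -- `e` divides its own factorial, which divides `N !`.
    order-≥ e@(suc e-1) j {u} {v} e≤N u≤ v≤ with ∣-trans (m∣m*n (e-1 !)) (m≤n⇒m!∣n! e≤N)
    ... | divides f K≡f*e = begin
      cmp ((e ℕ.+ j) • c ∙ u ⊙ p) (j • c ∙ v ⊙ p)
        ≡⟨ cmp-clear e f j (sym K≡f*e) c _ _ ⟩
      cmp (f • (u ⊙ p) ∙ K • c) (f • (v ⊙ p))
        ≡⟨ cong₂ (λ x y → cmp (x ∙ K • c) y) (⊙-homo-* f u p) (⊙-homo-* f v p) ⟨
      _ ≡⟨ aligned (bounded-* u≤) (bounded-* v≤) ⟩
      _ ≡⟨ cong₂ (λ x y → cmp (x ∙ K • d) y) (⊙-homo-* f u q) (⊙-homo-* f v q) ⟩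
      cmp (f • (u ⊙ q) ∙ K • d) (f • (v ⊙ q))
        ≡⟨ cmp-clear e f j (sym K≡f*e) d _ _ ⟨
      cmp ((e ℕ.+ j) • d ∙ u ⊙ q) (j • d ∙ v ⊙ q) ∎
      where
      open ≡-Reasoning
      instance
        f≢0 : NonZero f
        f≢0 = ℕₚ.m*n≢0⇒m≢0 f {e} {{subst NonZero K≡f*e K≢0}}
      f≤K : f ≤ K
      f≤K = subst (f ≤_) (sym K≡f*e) (ℕₚ.m≤m*n f e)
      bounded-* : ∀ {u} → All (_≤ N) u → All (_≤ L) (Vec.map (f ℕ.*_) u)
      bounded-* = Allₚ.map⁺ ∘ All.map (ℕₚ.*-mono-≤ f≤K)

    order′ : ∀ {u v} → All (_≤ N) u → All (_≤ N) v →
             cmp (u ⊙ (c ∷ p)) (v ⊙ (c ∷ p)) ≡ cmp (u ⊙ (d ∷ q)) (v ⊙ (d ∷ q))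
    order′ {i ∷ u} {j ∷ v} (i≤ ∷ u≤) (j≤ ∷ v≤) with ℕₚ.≤-total j i
    ... | inj₁ j≤i = subst
            (λ i → cmp (i • c ∙ u ⊙ p) (j • c ∙ v ⊙ p) ≡ cmp (i • d ∙ u ⊙ q) (j • d ∙ v ⊙ q))
            (ℕₚ.m∸n+n≡m j≤i)
            (order-≥ (i ℕ.∸ j) j (ℕₚ.≤-trans (ℕₚ.m∸n≤m i j) i≤) u≤ v≤)
    -- Reversing both comparisons puts the larger exponent on the left.
    ... | inj₂ i≤j = trans (cmp-swap _ _) (trans (cong opposite (subst
            (λ j → cmp (j • c ∙ v ⊙ p) (i • c ∙ u ⊙ p) ≡ cmp (j • d ∙ v ⊙ q) (i • d ∙ u ⊙ q))
            (ℕₚ.m∸n+n≡m i≤j)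
            (order-≥ (j ℕ.∸ i) i (ℕₚ.≤-trans (ℕₚ.m∸n≤m j i) j≤) v≤ u≤))) (sym (cmp-swap _ _)))

  ⊙-• : ∀ k (u : Vec ℕ n) p → u ⊙ Vec.map (k •_) p ≡ k • (u ⊙ p)
  ⊙-• k []      []      = sym (•-zeroʳ k)
  ⊙-• k (l ∷ u) (x ∷ p) = trans (cong₂ _∙_ (•-swap l k x) (⊙-• k u p)) (sym (•-distrib-∙ _ _ k))

  -- `suc M •_` is a strictly increasing endomorphism, so it respects the order of monomials of
  -- every size, and it changes each `x` by `M • x`.
  Similar-• : ∀ N M (p : Vec Carrier n) → Similar N M p (Vec.map (suc M •_) p)
  Similar-• N M p = record
    { shift = shift′ p
    ; order = λ {u} {v} _ _ → sym (trans
        (cong₂ cmp (⊙-• (suc M) u p) (⊙-• (suc M) v p)) (cmp-mono (•-monoʳ-< (suc M)) _ _))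
    }
    where
    shift′ : ∀ {n} (p : Vec Carrier n) → Pointwise (λ x y → y ≡ x mod M) p (Vec.map (suc M •_) p)
    shift′ []      = []
    shift′ (x ∷ p) = (x , refl) ∷ shift′ p

-- The multiplicative group of positive rationals.

open GroupProperties ℚₚ.+-0-group using () renaming (⁻¹-involutive to neg-involutive)

-- Positivity is proof-irrelevant, so propositional equality reduces to equality of values.
record ℚ⁺ : Set where
  constructor pos
  field
    value       : ℚ
    .{{positive}} : Positive value

open ℚ⁺

value-injective : ∀ {x y} → value x ≡ value y → x ≡ y
value-injective {pos _} {pos _} refl = refl

value>0 : ∀ x → 0ℚ ℚ.< value x
value>0 (pos a) = ℚₚ.positive⁻¹ a

fromℕ : ℕ → ℚ
fromℕ n = mkℚ (+ n) 0 (Coprimality.sym (1-coprimeTo n))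

fromℕ-suc : ∀ n → fromℕ (suc n) ≡ 1ℚ + fromℕ n
fromℕ-suc n = ℚₚ.toℚᵘ-injective (ℚᵘₚ.≃-trans
  (ℚᵘ.*≡* (lemma (+ n))) (ℚᵘₚ.≃-sym (ℚₚ.toℚᵘ-homo-+ 1ℚ (fromℕ n))))
  where
  lemma : ∀ i → (+ 1 ℤ.+ i) ℤ.* + 1 ≡ (+ 1 ℤ.+ i ℤ.* + 1) ℤ.* + 1
  lemma = solve-∀

-- A nonnegative fraction is at most its numerator; a negative one is below zero.
<-fromℕ : ∀ y → ∃ λ n → y ℚ.< fromℕ n
<-fromℕ (mkℚ -[1+ m ] d _) = 0 , *<* -<+
<-fromℕ (mkℚ (+ m)    d _) = suc m , *<* (subst₂ ℤ._<_
  (ℤₚ.pos-* m 1) (ℤₚ.pos-* (suc m) (suc d)) (+<+ (begin-strict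
    m ℕ.* 1            ≡⟨ ℕₚ.*-identityʳ m ⟩
    m                  <⟨ ℕₚ.n<1+n m ⟩
    suc m              ≤⟨ ℕₚ.m≤m*n (suc m) (suc d) ⟩
    suc m ℕ.* suc d    ∎)))
  where open ℕₚ.≤-Reasoning

infixl 7 _*⁺_
_*⁺_ : ℚ⁺ → ℚ⁺ → ℚ⁺
pos a *⁺ pos b = pos (a * b) {{ℚₚ.pos*pos⇒pos a b}}

1/⁺ : ℚ⁺ → ℚ⁺
1/⁺ (pos a) = pos ((ℚ.1/ a) {{ℚₚ.pos⇒nonZero a}}) {{ℚₚ.1/pos⇒pos a}}

archimedean-* : ∀ {δ} y → 0ℚ ℚ.< δ → ∃ λ n → y ℚ.< fromℕ n * δ
archimedean-* {δ} y 0<δ = n , (begin-strict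
  y                   ≡⟨ ℚₚ.*-identityʳ y ⟨
  y * 1ℚ              ≡⟨ cong (y *_) (ℚₚ.*-inverseˡ δ) ⟨
  y * (ℚ.1/ δ * δ)    ≡⟨ ℚₚ.*-assoc y (ℚ.1/ δ) δ ⟨
  y * ℚ.1/ δ * δ      <⟨ ℚₚ.*-monoˡ-<-pos δ y/δ<n ⟩
  fromℕ n * δ         ∎)
  where
  open ℚₚ.≤-Reasoning
  instance
    δ-positive : Positive δ
    δ-positive = ℚ.positive 0<δ
    δ≢0 : ℚ.NonZero δ
    δ≢0 = ℚₚ.pos⇒nonZero δ
  n     = proj₁ (<-fromℕ (y * ℚ.1/ δ))
  y/δ<n = proj₂ (<-fromℕ (y * ℚ.1/ δ))

*⁺-isAbelianGroup : IsAbelianGroup _≡_ _*⁺_ (pos 1ℚ) 1/⁺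
*⁺-isAbelianGroup = record
  { isGroup = record
    { isMonoid = record
      { isSemigroup = record
        { isMagma = record { isEquivalence = isEquivalence ; ∙-cong = cong₂ _*⁺_ }
        ; assoc   = λ x y z → value-injective (ℚₚ.*-assoc (value x) (value y) (value z))
        }
      ; identity = (λ x → value-injective (ℚₚ.*-identityˡ (value x)))
                 , (λ x → value-injective (ℚₚ.*-identityʳ (value x)))
      }
    ; inverse = (λ { (pos a) → value-injective (ℚₚ.*-inverseˡ a {{ℚₚ.pos⇒nonZero a}}) })
              , (λ { (pos a) → value-injective (ℚₚ.*-inverseʳ a {{ℚₚ.pos⇒nonZero a}}) })
    ; ⁻¹-cong = cong 1/⁺
    }
  ; comm = λ x y → value-injective (ℚₚ.*-comm (value x) (value y))
  }

infix 4 _<⁺_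
_<⁺_ : Rel ℚ⁺ _
x <⁺ y = value x ℚ.< value y

<⁺-compare : Trichotomous _≡_ _<⁺_
<⁺-compare x y with ℚₚ.<-cmp (value x) (value y)
... | tri< x<y x≢y y≮x = tri< x<y (x≢y ∘ cong value) y≮x
... | tri≈ x≮y x≡y y≮x = tri≈ x≮y (value-injective x≡y) y≮x
... | tri> x≮y x≢y y<x = tri> x≮y (x≢y ∘ cong value) y<x

-- Definitionally the `_•_` of `positiveRationals`, stated beforehand because its unboundedness is a
-- field of that record.
power : ℕ → ℚ⁺ → ℚ⁺
power = Multiple._×_ (AbelianGroup.rawMonoid (record { isAbelianGroup = *⁺-isAbelianGroup }))

module _ (x : ℚ⁺) (1<x : pos 1ℚ <⁺ x) where
  open ℚₚ.≤-Reasoning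

  private
    δ = value x - 1ℚ

    0<δ : 0ℚ ℚ.< δ
    0<δ = subst (ℚ._< δ) (ℚₚ.+-inverseʳ 1ℚ) (ℚₚ.+-monoˡ-< (ℚ.- 1ℚ) 1<x)

    x≡1+δ : value x ≡ 1ℚ + δ
    x≡1+δ = sym (trans (ℚₚ.+-comm 1ℚ δ) (trans (ℚₚ.+-assoc (value x) (ℚ.- 1ℚ) 1ℚ)
      (trans (cong (λ z → value x + z) (ℚₚ.+-inverseˡ 1ℚ)) (ℚₚ.+-identityʳ (value x)))))

    instance
      δ-nonNegative : ℚ.NonNegative δ
      δ-nonNegative = ℚ.nonNegative (ℚₚ.<⇒≤ 0<δ)

    power-step : ∀ n → value (power (suc n) x) ≡ value (power n x) + δ * value (power n x)
    power-step n = trans (cong (_* v) x≡1+δ)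
      (trans (ℚₚ.*-distribʳ-+ v 1ℚ δ) (cong (_+ δ * v) (ℚₚ.*-identityˡ v)))
      where v = value (power n x)

    power-nonNegative : ∀ n → ℚ.NonNegative (value (power n x))
    power-nonNegative n = ℚₚ.pos⇒nonNeg (value (power n x))
      {{ℚ.positive {value (power n x)} (value>0 (power n x))}}

    1≤power : ∀ n → 1ℚ ℚ.≤ value (power n x)
    1≤power zero    = ℚₚ.≤-refl
    1≤power (suc n) = begin
      1ℚ                                          ≤⟨ 1≤power n ⟩
      value (power n x)                           ≡⟨ ℚₚ.*-identityˡ _ ⟨
      1ℚ * value (power n x)
        ≤⟨ ℚₚ.*-monoʳ-≤-nonNeg (value (power n x)) {{power-nonNegative n}} (ℚₚ.<⇒≤ 1<x) ⟩
      value x * value (power n x)                 ∎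

    -- Bernoulli's inequality without the summand one: each further factor adds `δ` times a power
    -- that is at least one.
    bernoulli : ∀ n → fromℕ n * δ ℚ.≤ value (power n x)
    bernoulli zero    = subst (ℚ._≤ 1ℚ) (sym (ℚₚ.*-zeroˡ δ)) (ℚ.*≤* (ℤ.+≤+ z≤n))
    bernoulli (suc n) = begin
      fromℕ (suc n) * δ                           ≡⟨ cong (_* δ) (fromℕ-suc n) ⟩
      (1ℚ + fromℕ n) * δ                          ≡⟨ ℚₚ.*-distribʳ-+ δ 1ℚ (fromℕ n) ⟩
      1ℚ * δ + fromℕ n * δ                        ≡⟨ ℚₚ.+-comm (1ℚ * δ) (fromℕ n * δ) ⟩
      fromℕ n * δ + 1ℚ * δ                        ≡⟨ cong (λ z → fromℕ n * δ + z) (ℚₚ.*-comm 1ℚ δ) ⟩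
      fromℕ n * δ + δ * 1ℚ                        ≤⟨ ℚₚ.+-mono-≤ (bernoulli n) (ℚₚ.*-monoˡ-≤-nonNeg δ (1≤power n)) ⟩
      value (power n x) + δ * value (power n x)   ≡⟨ power-step n ⟨
      value (power (suc n) x)                     ∎

  power-unbounded : ∀ y → ∃ λ n → y <⁺ power n x
  power-unbounded y = let n , y<nδ = archimedean-* (value y) 0<δ in
    n , ℚₚ.<-≤-trans y<nδ (bernoulli n)

positiveRationals : DenseArchimedeanGroup
positiveRationals = record
  { Carrier            = ℚ⁺
  ; _<_                = _<⁺_
  ; _∙_                = _*⁺_
  ; ε                  = pos 1ℚ
  ; _⁻¹                = 1/⁺
  ; isAbelianGroup     = *⁺-isAbelianGroup
  ; isStrictTotalOrder = record
    { isStrictPartialOrder = record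
      { isEquivalence = isEquivalence
      ; irrefl        = λ { refl → ℚₚ.<-irrefl refl }
      ; trans         = ℚₚ.<-trans
      ; <-resp-≈      = (λ { refl x<y → x<y }) , (λ { refl x<y → x<y })
      }
    ; compare = <⁺-compare
    }
  ; ∙-monoʳ-<          = λ { (pos a) → ℚₚ.*-monoʳ-<-pos a }
  ; <-dense            = λ {x} x<y → let z , x<z , z<y = ℚₚ.<-dense x<y in
                           pos z {{ℚ.positive (ℚₚ.<-trans (value>0 x) x<z)}} , x<z , z<y
  ; nontrivial         = pos (1ℚ + 1ℚ) , *<* (+<+ (s≤s (s≤s z≤n)))
  ; archimedean        = λ {x} y 1<x → power-unbounded x 1<x y
  }

open DenseArchimedeanGroup positiveRationals using (_•_; _∙_)
open DenseArchimedeanGroupProperties positiveRationals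

-- Rationals as signs with positive magnitudes.

infixl 7 _*ˢ_
_*ˢ_ : Sgn → Sgn → Sgn
⊖ *ˢ s = opposite s
○ *ˢ s = ○
⊕ *ˢ s = s

infixr 8 _◂_
_◂_ : Sgn → ℚ⁺ → ℚ
⊖ ◂ x = ℚ.- value x
○ ◂ x = 0ℚ
⊕ ◂ x = value x

◂-* : ∀ s t x y → (s ◂ x) * (t ◂ y) ≡ (s *ˢ t) ◂ (x *⁺ y)
◂-* ⊖ ⊖ x y = trans (sym (ℚₚ.neg-distribˡ-* (value x) (ℚ.- value y)))
  (trans (cong ℚ.-_ (sym (ℚₚ.neg-distribʳ-* (value x) (value y)))) (neg-involutive _))
◂-* ⊖ ○ x y = ℚₚ.*-zeroʳ (ℚ.- value x)
◂-* ⊖ ⊕ x y = sym (ℚₚ.neg-distribˡ-* (value x) (value y))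
◂-* ○ t x y = ℚₚ.*-zeroˡ (t ◂ y)
◂-* ⊕ ⊖ x y = sym (ℚₚ.neg-distribʳ-* (value x) (value y))
◂-* ⊕ ○ x y = ℚₚ.*-zeroʳ (value x)
◂-* ⊕ ⊕ x y = refl

polar : ∀ a → ∃ λ s → ∃ λ x → s ◂ x ≡ a
polar a with ℚₚ.<-cmp a 0ℚ
... | tri< a<0 _ _ = ⊖ , pos (ℚ.- a) {{ℚ.positive (ℚₚ.neg-antimono-< a<0)}} , neg-involutive a
-- Zero has no magnitude of its own; one is a placeholder.
... | tri≈ _ a≡0 _ = ○ , pos 1ℚ , sym a≡0
... | tri> _ _ 0<a = ⊕ , pos a {{ℚ.positive 0<a}} , refl

≤⇒≯ : ∀ {a b} → a ℚ.≤ b → ¬ (b ℚ.< a)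
≤⇒≯ a≤b b<a = ℚₚ.<-irrefl refl (ℚₚ.<-≤-trans b<a a≤b)

value-≤-transfer : ∀ {x y x′ y′} → cmp x y ≡ cmp x′ y′ →
                   value x ℚ.≤ value y → value x′ ℚ.≤ value y′
value-≤-transfer {x} {y} {x′} {y′} eq x≤y = ℚₚ.≮⇒≥ λ y′<x′ →
  ≤⇒≯ x≤y (cmp⇒< (trans (cmp-swap y x) (cong opposite (trans eq (>⇒cmp y′<x′)))))

neg<0 : ∀ x → ℚ.- value x ℚ.< 0ℚ
neg<0 x = ℚₚ.neg-antimono-< (value>0 x)

-- Distinct signs decide the comparison by themselves. Equal nonzero signs leave it to the
-- magnitudes, in reverse order for negative numbers.
◂-≤-transfer : ∀ s t {x y x′ y′} → cmp x y ≡ cmp x′ y′ → s ◂ x ℚ.≤ t ◂ y → s ◂ x′ ℚ.≤ t ◂ y′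
◂-≤-transfer ⊖ ⊖ {x} {y} eq x≤y = ℚₚ.neg-antimono-≤ (value-≤-transfer
  (trans (cmp-swap y x) (trans (cong opposite eq) (sym (cmp-swap _ _))))
  (subst₂ ℚ._≤_ (neg-involutive _) (neg-involutive _) (ℚₚ.neg-antimono-≤ x≤y)))
◂-≤-transfer ⊖ ○ {x′ = x′} _ _ = ℚₚ.<⇒≤ (neg<0 x′)
◂-≤-transfer ⊖ ⊕ {x′ = x′} {y′} _ _ = ℚₚ.<⇒≤ (ℚₚ.<-trans (neg<0 x′) (value>0 y′))
◂-≤-transfer ○ ⊖ {y = y} _ 0≤-y = contradiction (neg<0 y) (≤⇒≯ 0≤-y)
◂-≤-transfer ○ ○ _ _ = ℚₚ.≤-refl
◂-≤-transfer ○ ⊕ {y′ = y′} _ _ = ℚₚ.<⇒≤ (value>0 y′)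
◂-≤-transfer ⊕ ⊖ {x} {y} _ x≤-y = contradiction (ℚₚ.<-trans (neg<0 y) (value>0 x)) (≤⇒≯ x≤-y)
◂-≤-transfer ⊕ ○ {x} _ x≤0 = contradiction (value>0 x) (≤⇒≯ x≤0)
◂-≤-transfer ⊕ ⊕ eq x≤y = value-≤-transfer eq x≤y

-- Terms as signed monomials.

sign : ∀ {n} → Term n → Vec Sgn n → Sgn
sign (var i) s = lookup s i
sign (t · u) s = sign t s *ˢ sign u s

exponents : ∀ {n} → Term n → Vec ℕ n
exponents {n} (var i) = replicate n 0 [ i ]≔ 1
exponents     (t · u) = zipWith ℕ._+_ (exponents t) (exponents u)

⊙-unit : ∀ {n} (i : Fin n) p → (replicate n 0 [ i ]≔ 1) ⊙ p ≡ lookup p i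
⊙-unit zero    (x ∷ p) = trans (cong₂ _∙_ (•-homo-1 x) (⊙-zero p)) (identityʳ x)
⊙-unit (suc i) (x ∷ p) = trans (identityˡ _) (⊙-unit i p)

eval-◂ : ∀ {n} (t : Term n) s p →
         eval ⟨ℚ,·,≤⟩ t (zipWith _◂_ s p) ≡ sign t s ◂ (exponents t ⊙ p)
eval-◂ (var i) s p = trans (lookup-zipWith _◂_ i s p) (cong (lookup s i ◂_) (sym (⊙-unit i p)))
eval-◂ (t · u) s p = begin
  eval ⟨ℚ,·,≤⟩ t ρ * eval ⟨ℚ,·,≤⟩ u ρ
    ≡⟨ cong₂ _*_ (eval-◂ t s p) (eval-◂ u s p) ⟩
  (sign t s ◂ (exponents t ⊙ p)) * (sign u s ◂ (exponents u ⊙ p))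
    ≡⟨ ◂-* (sign t s) (sign u s) _ _ ⟩
  (sign t s *ˢ sign u s) ◂ (exponents t ⊙ p ∙ exponents u ⊙ p)
    ≡⟨ cong ((sign t s *ˢ sign u s) ◂_) (⊙-homo-+ (exponents t) (exponents u) p) ⟨
  (sign t s *ˢ sign u s) ◂ (exponents (t · u) ⊙ p) ∎
  where
  open ≡-Reasoning
  ρ = zipWith _◂_ s p

-- Preservation of formulas under similarity.

bound : ∀ {n} (u : Vec ℕ n) → ∃ λ N → All (_≤ N) u
bound []      = 0 , []
bound (k ∷ u) = let N , u≤N = bound u in
  k ℕ.⊔ N , ℕₚ.m≤m⊔n k N ∷ bounded-mono (ℕₚ.m≤n⊔m k N) u≤N

-- One implication suffices, since similarity is symmetric. Both tuples carry the same signs, so the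
-- game concerns magnitudes only.
record Preserved {n} (φ : Formula n) : Set where
  field
    width         : ℕ
    modulus       : ℕ
    {{modulus≢0}} : NonZero modulus
    preserve      : ∀ s {p q} → Similar width modulus p q →
                    ⟨ℚ,·,≤⟩ ⊨ φ [ zipWith _◂_ s p ] → ⟨ℚ,·,≤⟩ ⊨ φ [ zipWith _◂_ s q ]

open Preserved

atomic-≤ : ∀ {n} (t u : Term n) → Preserved (t ≼ u)
atomic-≤ t u = record
  { width    = N
  -- Congruence modulo one always holds; signs and the order of monomials decide an atomic formula.
  ; modulus  = 1
  ; preserve = λ s {p} {q} S → subst₂ ℚ._≤_ (sym (eval-◂ t s q)) (sym (eval-◂ u s q))
      ∘ ◂-≤-transfer (sign t s) (sign u s) (order S t≤N u≤N)
      ∘ subst₂ ℚ._≤_ (eval-◂ t s p) (eval-◂ u s p)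
  }
  where
  N   = proj₁ (bound (exponents t ++ exponents u))
  t≤N = proj₁ (Allₚ.++⁻ (exponents t) (proj₂ (bound (exponents t ++ exponents u))))
  u≤N = proj₂ (Allₚ.++⁻ (exponents t) (proj₂ (bound (exponents t ++ exponents u))))

module _ {n} {φ ψ : Formula n} (Pφ : Preserved φ) (Pψ : Preserved ψ) where
  private
    N = width Pφ ℕ.⊔ width Pψ
    M = modulus Pφ ℕ.* modulus Pψ

    instance
      M≢0 : NonZero M
      M≢0 = ℕₚ.m*n≢0 (modulus Pφ) (modulus Pψ)

    left : ∀ {p q : Vec ℚ⁺ n} → Similar N M p q → Similar (width Pφ) (modulus Pφ) p q
    left = Similar-weaken (ℕₚ.m≤m⊔n (width Pφ) (width Pψ)) (m∣m*n (modulus Pψ))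

    right : ∀ {p q : Vec ℚ⁺ n} → Similar N M p q → Similar (width Pψ) (modulus Pψ) p q
    right = Similar-weaken (ℕₚ.m≤n⊔m (width Pφ) (width Pψ)) (n∣m*n (modulus Pφ))

  Preserved-∧ : Preserved (φ ∧ ψ)
  Preserved-∧ = record
    { preserve = λ s S (a , b) → preserve Pφ s (left S) a , preserve Pψ s (right S) b }

  Preserved-∨ : Preserved (φ ∨ ψ)
  Preserved-∨ = record
    { preserve = λ s S → Sum.map (preserve Pφ s (left S)) (preserve Pψ s (right S)) }

  Preserved-⇒ : Preserved (φ ⇒ ψ)
  Preserved-⇒ = record
    -- The premise travels backwards, from `q` to `p`.
    { preserve = λ s S f → preserve Pψ s (right S) ∘ f ∘ preserve Pφ s (left (Similar-sym S)) }

module _ {n} {φ : Formula (suc n)} (Pφ : Preserved φ) where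
  private
    N = width Pφ
    M = modulus Pφ
    L = (N !) ℕ.* N

    instance
      K*M≢0 : NonZero ((N !) ℕ.* M)
      K*M≢0 = ℕₚ.m*n≢0 (N !) M {{N ℕₚ.!≢0}}

    -- One round of the game: the sign of the witness is copied and `extend` answers its magnitude.
    preserve-∃ : ∀ s {p q} → Similar (L ℕ.+ L) ((N !) ℕ.* M) p q →
                 ⟨ℚ,·,≤⟩ ⊨ ∃′ φ [ zipWith _◂_ s p ] → ⟨ℚ,·,≤⟩ ⊨ ∃′ φ [ zipWith _◂_ s q ]
    preserve-∃ s S (a , φa) with polar a
    ... | σ , c , refl = let d , S′ = extend N M S c in σ ◂ d , preserve Pφ (σ ∷ s) S′ φa

    -- The challenge is now made beside `q` and answered beside `p`, so the similarity is reversed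
    -- twice.
    preserve-∀ : ∀ s {p q} → Similar (L ℕ.+ L) ((N !) ℕ.* M) p q →
                 ⟨ℚ,·,≤⟩ ⊨ ∀′ φ [ zipWith _◂_ s p ] → ⟨ℚ,·,≤⟩ ⊨ ∀′ φ [ zipWith _◂_ s q ]
    preserve-∀ s S φ∀ a with polar a
    ... | σ , c , refl = let d , S′ = extend N M (Similar-sym S) c in
          preserve Pφ (σ ∷ s) (Similar-sym S′) (φ∀ (σ ◂ d))

  Preserved-∃ : Preserved (∃′ φ)
  Preserved-∃ = record { preserve = preserve-∃ }

  Preserved-∀ : Preserved (∀′ φ)
  Preserved-∀ = record { preserve = preserve-∀ }

preserved : ∀ {n} (φ : Formula n) → Preserved φ
-- Equality is handled as two inequalities.
preserved (t ≐ u) = record { preserve = λ s S t≡u →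
    let t≤u , u≤t = preserve t≼u∧u≼t s S (ℚₚ.≤-reflexive t≡u , ℚₚ.≤-reflexive (sym t≡u))
    in ℚₚ.≤-antisym t≤u u≤t }
  where t≼u∧u≼t = Preserved-∧ (atomic-≤ t u) (atomic-≤ u t)
preserved (t ≼ u) = atomic-≤ t u
preserved ⊥′      = record { width = 0 ; modulus = 1 ; preserve = λ _ _ () }
preserved (φ ∧ ψ) = Preserved-∧ (preserved φ) (preserved ψ)
preserved (φ ∨ ψ) = Preserved-∨ (preserved φ) (preserved ψ)
preserved (φ ⇒ ψ) = Preserved-⇒ (preserved φ) (preserved ψ)
preserved (∀′ φ)  = Preserved-∀ (preserved φ)
preserved (∃′ φ)  = Preserved-∃ (preserved φ)

-- Undefinability of addition.

mainTheorem5 : ¬ (∃ λ (φ : Formula 3) → ∀ (x y z : ℚ) → (x + y ≡ z) ⇔ (⟨ℚ,·,≤⟩ ⊨ φ [ x ∷ y ∷ z ∷ [] ]))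
mainTheorem5 (φ , defines) =
  -- `two` is also the witness of `nontrivial`, so `M • two` exceeds `ε`, and `suc M • two`, which
  -- unfolds to `two ∙ M • two`, exceeds `two`.
  ℚₚ.<-irrefl 2≡2ᴹ⁺¹ (x<x∙y {y = M • two} two (•-positive M {{modulus≢0 P}} (proj₂ nontrivial)))
  where
  open DenseArchimedeanGroup positiveRationals using (ε; nontrivial)
  P   = preserved φ
  M   = modulus P
  two = pos (1ℚ + 1ℚ)
  s   = ⊕ ∷ ⊕ ∷ ⊕ ∷ []
  p   = ε ∷ ε ∷ two ∷ []

  image : value (suc M • ε) + value (suc M • ε) ≡ value (suc M • two)
  image = Equivalence.from (defines _ _ _)
    -- The formula holds at `p` because `1 + 1 = 2` by computation.
    (preserve P s (Similar-• (width P) M p) (Equivalence.to (defines _ _ _) refl))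

  2≡2ᴹ⁺¹ : 1ℚ + 1ℚ ≡ value (suc M • two)
  2≡2ᴹ⁺¹ = trans (cong (λ x → value x + value x) (sym (•-zeroʳ (suc M)))) image
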